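{- For every $k\ge 1$: (1) there exist a generalized reachability game $\mathcal{G} = (\mathcal{A},\mathrm{GenReach}(F_1,\ldots,F_k))$ and a starting vertex $v_0$ such that Eve wins from $v_0$, but Eve has no winning strategy from $v_0$ that uses a memory structure with fewer than $2^k-1$ memory states; (2) there exist a generalized reachability game $\mathcal{G} = (\mathcal{A},\mathrm{GenReach}(F_1,\ldots,F_k))$ and a starting vertex $v_0$ such that Adam wins from $v_0$, but Adam has no winning strategy from $v_0$ that uses a memory structure with fewer than $\binom{k}{\lfloor k/2\rfloor}$ memory states.
   Context: An arena $\mathcal{A} = (V,(V_\circ,V_\Box),E)$ consists of a finite directed graph $(V,E)$, in which every vertex has at least one outgoing edge, and a partition $(V_\circ,V_\Box)$ of $V$: vertices in $V_\circ$ are controlled by Eve, vertices in $V_\Box$ by Adam. A play is an infinite path $\pi = v_0,v_1,v_2,\ldots$ in the graph. A strategy for Eve is a function $\sigma : V^*\cdot V_\circ \to V$ with $(v,\sigma(w\cdot v))\in E$ for all $w \in V^*$, $v \in V_\circ$; strategies $\tau$ for Adam are defined similarly with $V_\Box$. A starting vertex $v_0$ and strategies $\sigma,\tau$ determine a unique play $\pi(v_0,\sigma,\tau)$. A game is a pair $(\mathcal{A},\Phi)$ with $\Phi$ a set of plays; Eve wins a play iff it belongs to $\Phi$, and Adam wins it otherwise. A strategy $\sigma$ of Eve is winning from $v_0$ if $\pi(v_0,\sigma,\tau)\in\Phi$ for every strategy $\tau$ of Adam; a strategy $\tau$ of Adam is winning from $v_0$ if $\pi(v_0,\sigma,\tau)\notin\Phi$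 for every strategy $\sigma$ of Eve. A player wins from $v_0$ if he or she has a winning strategy from $v_0$. Given subsets $F_1,\ldots,F_k \subseteq V$, the generalized reachability objective is $$\mathrm{GenReach}(F_1,\ldots,F_k) = \{ v_0,v_1,v_2,\ldots \mid \forall i\in\{1,\ldots,k\},\ \exists p_i\in\mathbb{N},\ v_{p_i}\in F_i\}.$$ A generalized reachability game is a game of the form $(\mathcal{A},\mathrm{GenReach}(F_1,\ldots,F_k))$. A memory structure $\mathcal{M}=(M,m_0,\mu)$ for $\mathcal{A}$ consists of a set $M$ of memory states, an initial memory state $m_0\in M$, and an update function $\mu: M\times E\to M$. It is extended to $\mu^*:V^+\to M$ (on finite paths) by $\mu^*(v)=m_0$ and $\mu^*(w\cdot u\cdot v)=\mu(\mu^*(w\cdot u),(u,v))$. A strategy for Eve uses the memory structure $\mathcal{M}$ if it is given by a next-move function $\nu: V_\circ\times M\to V$ via $\sigma(w\cdot v)=\nu(v,\mu^*(w\cdot v))$; similarly for Adam with $V_\Box$ in place of $V_\circ$. The number of memory states is $|M|$. -}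

module Defs where

open import Data.Bool.Base using (Bool; T)
open import Data.Fin.Base using (Fin)
open import Data.List.Base using (List; []; _∷_)
open import Data.Nat.Base using (ℕ; zero; suc; _<_)
open import Data.Product.Base using (Σ-syntax; ∃-syntax; ∃₂; _×_; _,_; proj₁; proj₂)
open import Function.Bundles using (_↔_)
open import Level using (0ℓ)
open import Relation.Binary.PropositionalEquality.Core using (_≡_; refl)
open import Relation.Nullary.Negation.Core using (¬_)
open import Relation.Unary using (Pred)

data Player : Set where
  eve adam : Player

-- The edge set and other subsets of a finite set are given by Boolean
-- characteristic functions, so there are no parallel edges.  The partition
-- (V∘ , V□) is the pair of fibres of `owner`.
record Arena : Set₁ where
  field
    V      : Set
    size   : ℕ
    finite : V ↔ Fin size
    edge   : V → V → Bool
    total  : ∀ u → ∃[ v ] T (edge u v)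
    owner  : V → Player

  Edge : Set
  Edge = ∃₂ λ u v → T (edge u v)

  Subset : Set
  Subset = V → Bool

  record Play : Set where
    field
      at     : ℕ → V
      isPath : ∀ n → T (edge (at n) (at (suc n)))

  -- A non-empty word w·v is represented by the list w, most recent vertex
  -- first, together with its last vertex v.  As in V*·V∘ → V, the word need
  -- not be a path.
  Strategy : Player → Set
  Strategy P = (w : List V) (v : V) → owner v ≡ P → ∃[ u ] T (edge v u)

  module _ (v₀ : V) (σ : Strategy eve) (τ : Strategy adam) where

    next : (w : List V) (v : V) → ∃[ u ] T (edge v u)
    next w v = choose (owner v) refl
      where
      choose : (P : Player) → owner v ≡ P → ∃[ u ] T (edge v u)
      choose eve  eq = σ w v eq
      choose adam eq = τ w v eq

    prefix : ℕ → List V × V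
    prefix zero    = [] , v₀
    prefix (suc n) = let (w , v) = prefix n in (v ∷ w) , proj₁ (next w v)

    play : Play
    play = record
      { at     = λ n → proj₂ (prefix n)
      ; isPath = λ n → let (w , v) = prefix n in proj₂ (next w v)
      }

  GenReach : ∀ {k} → (Fin k → Subset) → Pred Play 0ℓ
  GenReach F π = ∀ i → ∃[ p ] T (F i (Play.at π p))

  -- FinitePath w v: the word w·v (encoded as in `Strategy`) is a path.
  data FinitePath : List V → V → Set where
    start : ∀ {v} → FinitePath [] v
    _▷_   : ∀ {w u v} → FinitePath w u → T (edge u v) → FinitePath (u ∷ w) v

  record MemoryStructure : Set₁ where
    field
      M  : Set
      m₀ : M
      μ  : M → Edge → M

    μ* : ∀ {w v} → FinitePath w v → M
    μ* start                   = m₀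
    μ* (_▷_ {u = u} {v = v} p e) = μ (μ* p) (u , v , e)

    -- μ* is defined on paths only, so the values of a strategy on words that
    -- are not paths (which never influence a play) are left unconstrained.
    UsedBy : ∀ {P} → Strategy P → Set
    UsedBy {P} σ =
      Σ[ ν ∈ ((v : V) → owner v ≡ P → M → V) ]
        (∀ {w v} (o : owner v ≡ P) (p : FinitePath w v) →
           proj₁ (σ w v o) ≡ ν v o (μ* p))

    FewerStatesThan : ℕ → Set
    FewerStatesThan n = ∃[ m ] (M ↔ Fin m) × m < n

record Game : Set₁ where
  field
    arena     : Arena
    objective : Pred (Arena.Play arena) 0ℓ

  open Arena arena

  Winning : (P : Player) → Strategy P → V → Set
  Winning eve  σ v₀ = ∀ (τ : Strategy adam) → objective (play v₀ σ τ)
  Winning adam τ v₀ = ∀ (σ : Strategy eve) → ¬ objective (play v₀ σ τ)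

  Wins : Player → V → Set
  Wins P v₀ = ∃[ σ ] Winning P σ v₀

  WinsWithFewerStatesThan : ℕ → Player → V → Set₁
  WinsWithFewerStatesThan n P v₀ =
    Σ[ 𝓜 ∈ MemoryStructure ] MemoryStructure.FewerStatesThan 𝓜 n ×
      (Σ[ σ ∈ Strategy P ] MemoryStructure.UsedBy 𝓜 σ × Winning P σ v₀)

genReachGame : (𝓐 : Arena) {k : ℕ} → (Fin k → Arena.Subset 𝓐) → Game
genReachGame 𝓐 F = record { arena = 𝓐 ; objective = Arena.GenReach 𝓐 F }

{-# OPTIONS --safe #-}
module Submission where

-- (1) At each visit to the heart Eve names a set T of colours and Adam
-- challenges one colour i: if i ∉ T then i is visited and the play returns to
-- the heart; if i ∈ T then all colours but i are visited and the play stays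
-- there for ever.  Naming exactly the colours visited so far is winning.  If
-- Eve never names T₀ ≠ ⊤, then Adam can always challenge a colour on which T
-- and T₀ differ, so that only colours of T₀ are visited before the play stops,
-- and it can only stop on a colour outside T₀.  Hence Eve has to name all
-- 2^k ∸ 1 proper subsets.
--
-- (2) Eve visits a set S with ⌊k/2⌋ colours, Adam names a set T of the same
-- size, and Eve picks i ∉ T and visits all colours but i.  Adam wins only by
-- naming T = S: otherwise S ⊈ T, and Eve picks i ∈ S ∖ T.

open import Data.Bool.Base using (Bool; true; false; T)
open import Data.Bool.Properties using (T-≡)
open import Data.Empty using (⊥)
open import Data.Fin.Base using (Fin; zero; suc)
open import Data.Fin.Properties using (1↔⊤; +↔⊎; _≟_; any?; ¬∀⟶∃¬; injective⇒≤)
open import Data.Fin.Subset using (Subset; _∈_; _∉_; _⊆_; _⊈_; _∪_; ∣_∣; inside; outside)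
  renaming (⊤ to full; ⊥ to empty)
open import Data.Fin.Subset.Properties
  using (_∈?_; _⊆?_; ∉⊥; ∈⊤; ⊆⊤; ⊆-antisym; p⊂q⇒∣p∣<∣q∣; ∣p∣≤n; ∣p∣≡n⇒p≡⊤; ∣⊤∣≡n;
         x∈p∪q⁻; x∈p∪q⁺)
open import Data.List.Base using (List; []; _∷_)
open import Data.Nat.Base using (ℕ; zero; suc; _≤_; _<_; _+_; _^_; _∸_; ⌊_/2⌋; z≤n; s≤s;
  _≤′_; ≤′-reflexive; ≤′-step)
open import Data.Nat.Combinatorics using (_C_; nCk+nC[k+1]≡[n+1]C[k+1])
import Data.Nat.Properties as ℕ
open import Data.Product.Base using (Σ-syntax; ∃-syntax; _×_; _,_; proj₁; proj₂)
open import Data.Sum.Base using (_⊎_; inj₁; inj₂)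
open import Data.Sum.Function.Propositional using (_⊎-cong_)
open import Data.Unit.Base using (⊤; tt)
open import Data.Vec.Base using ([]; _∷_; tabulate)
open import Data.Vec.Properties using (lookup∘tabulate; lookup⇒[]=; []=⇒lookup)
open import Function.Base using (_∘_)
open import Function.Bundles using (_↔_; mk↔ₛ′; Inverse; Equivalence)
open import Function.Construct.Composition using (_↔-∘_)
open import Function.Construct.Identity using (↔-id)
open import Function.Construct.Symmetry using (↔-sym)
open import Relation.Binary.PropositionalEquality
  using (_≡_; _≢_; refl; sym; trans; cong; subst)
open import Relation.Nullary.Decidable
  using (yes; no; ⌊_⌋; isNo; _×-dec_; ¬?; decidable-stable;
         toWitness; fromWitness; toWitnessFalse; fromWitnessFalse)
open import Relation.Nullary.Negation using (¬_; contradiction)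
open import Defs

-- Counting finite sets, subsets, and subsets of a given size.

infixr 1 _⊎-finite_

_⊎-finite_ : ∀ {A B : Set} {m n} → A ↔ Fin m → B ↔ Fin n → (A ⊎ B) ↔ Fin (m + n)
f ⊎-finite g = ↔-sym +↔⊎ ↔-∘ (f ⊎-cong g)

⊤-finite : ⊤ ↔ Fin 1
⊤-finite = ↔-sym 1↔⊤

-- Pigeonhole: if every element were hit, choosing preimages would inject `Fin n` into `Fin m`. The
-- search runs in `Fin n`, where equality is decidable.
missed : ∀ {A : Set} {m n} → A ↔ Fin n → m < n → (f : Fin m → A) → ∃[ a ] (∀ j → f j ≢ a)
missed {m = m} {n} A↔ m<n f =
  let (x , x∉) = ¬∀⟶∃¬ n _ (λ x → any? (λ j → to (f j) ≟ x)) notSurjective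
  in from x , λ j fj≡ → x∉ (j , trans (cong to fj≡) (inverseˡ refl))
  where
  open Inverse A↔
  notSurjective : ¬ (∀ x → ∃[ j ] to (f j) ≡ x)
  notSurjective hit = ℕ.<⇒≱ m<n (injective⇒≤ {f = proj₁ ∘ hit}
    λ {x} {y} eq → trans (sym (proj₂ (hit x))) (trans (cong (to ∘ f) eq) (proj₂ (hit y))))

Subset-∷ : ∀ {n} → Subset (suc n) ↔ (Subset n ⊎ Subset n)
Subset-∷ = mk↔ₛ′
  (λ { (inside ∷ p) → inj₁ p ; (outside ∷ p) → inj₂ p })
  (λ { (inj₁ p) → inside ∷ p ; (inj₂ p) → outside ∷ p })
  (λ { (inj₁ _) → refl ; (inj₂ _) → refl })
  (λ { (inside ∷ _) → refl ; (outside ∷ _) → refl })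

Subset-finite : ∀ n → Subset n ↔ Fin (2 ^ n)
Subset-finite zero    = mk↔ₛ′ (λ _ → zero) (λ _ → []) (λ { zero → refl }) (λ { [] → refl })
-- `2 ^ suc n` unfolds to `2 ^ n + (2 ^ n + 0)`; the transport supplies the trailing zero.
Subset-finite (suc n) = subst (λ m → Subset (suc n) ↔ Fin (2 ^ n + m)) (sym (ℕ.+-identityʳ (2 ^ n)))
  ((Subset-finite n ⊎-finite Subset-finite n) ↔-∘ Subset-∷)

SizedSubset : ℕ → ℕ → Set
SizedSubset n j = Σ[ p ∈ Subset n ] ∣ p ∣ ≡ j

SizedSubset-≡ : ∀ {n j} {p q : SizedSubset n j} → proj₁ p ≡ proj₁ q → p ≡ q
SizedSubset-≡ {p = p , eq} {_ , eq′} refl = cong (p ,_) (ℕ.≡-irrelevant eq eq′)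

SizedSubset-0 : ∀ {n} → SizedSubset (suc n) 0 ↔ SizedSubset n 0
SizedSubset-0 = mk↔ₛ′
  (λ { (outside ∷ p , eq) → p , eq ; (inside ∷ p , ()) })
  (λ { (p , eq) → outside ∷ p , eq })
  (λ _ → refl)
  (λ { (outside ∷ _ , _) → refl ; (inside ∷ _ , ()) })

SizedSubset-suc : ∀ {n j} → SizedSubset (suc n) (suc j) ↔ (SizedSubset n j ⊎ SizedSubset n (suc j))
SizedSubset-suc = mk↔ₛ′
  (λ { (inside ∷ p , refl) → inj₁ (p , refl) ; (outside ∷ p , eq) → inj₂ (p , eq) })
  (λ { (inj₁ (p , refl)) → inside ∷ p , refl ; (inj₂ (p , eq)) → outside ∷ p , eq })
  (λ { (inj₁ (_ , refl)) → refl ; (inj₂ _) → refl })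
  (λ { (inside ∷ _ , refl) → refl ; (outside ∷ _ , _) → refl })

-- Splitting on whether the first element belongs to the subset is Pascal's rule.
SizedSubset-finite : ∀ n j → SizedSubset n j ↔ Fin (n C j)
SizedSubset-finite zero    zero    = mk↔ₛ′
  (λ _ → zero) (λ _ → [] , refl) (λ { zero → refl }) (λ { ([] , refl) → refl })
SizedSubset-finite zero    (suc j) = mk↔ₛ′ (λ { ([] , ()) }) (λ ()) (λ ()) (λ { ([] , ()) })
SizedSubset-finite (suc n) zero    = SizedSubset-finite n zero ↔-∘ SizedSubset-0
SizedSubset-finite (suc n) (suc j) =
  subst (λ m → SizedSubset (suc n) (suc j) ↔ Fin m) (nCk+nC[k+1]≡[n+1]C[k+1] n j)
    ((SizedSubset-finite n j ⊎-finite SizedSubset-finite n (suc j)) ↔-∘ SizedSubset-suc)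

subsetOfSize : ∀ {n j} → j ≤ n → SizedSubset n j
subsetOfSize {zero}  z≤n       = [] , refl
subsetOfSize {suc n} z≤n       = let (p , eq) = subsetOfSize z≤n in outside ∷ p , eq
subsetOfSize         (s≤s j≤n) = let (p , eq) = subsetOfSize j≤n in inside ∷ p , cong suc eq

-- Elements that separate two subsets.

⊈⇒∃∈∉ : ∀ {n} {p q : Subset n} → p ⊈ q → ∃[ i ] i ∈ p × i ∉ q
⊈⇒∃∈∉ {p = p} {q} p⊈q with any? (λ i → (i ∈? p) ×-dec ¬? (i ∈? q))
... | yes found = found
... | no ¬found = contradiction
  (λ {i} i∈p → decidable-stable (i ∈? q) (λ i∉q → ¬found (i , i∈p , i∉q))) p⊈q

≢⇒⊈⊎⊈ : ∀ {n} {p q : Subset n} → p ≢ q → p ⊈ q ⊎ q ⊈ p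
≢⇒⊈⊎⊈ {p = p} {q} p≢q with p ⊆? q
... | yes p⊆q = inj₂ (λ q⊆p → p≢q (⊆-antisym p⊆q q⊆p))
... | no  p⊈q = inj₁ p⊈q

-- An inclusion between distinct sets is strict, so it would raise the cardinality.
∣p∣≡∣q∣∧≢⇒⊈ : ∀ {n} {p q : Subset n} → ∣ p ∣ ≡ ∣ q ∣ → p ≢ q → p ⊈ q
∣p∣≡∣q∣∧≢⇒⊈ ∣p∣≡∣q∣ p≢q p⊆q with ≢⇒⊈⊎⊈ p≢q
... | inj₁ p⊈q = p⊈q p⊆q
... | inj₂ q⊈p = ℕ.<⇒≢ (p⊂q⇒∣p∣<∣q∣ (p⊆q , ⊈⇒∃∈∉ q⊈p)) ∣p∣≡∣q∣

≢full⇒∃∉ : ∀ {n} {p : Subset n} → p ≢ full → ∃[ i ] i ∉ p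
≢full⇒∃∉ p≢full = let (i , _ , i∉p) = ⊈⇒∃∈∉ (λ full⊆p → p≢full (⊆-antisym ⊆⊤ full⊆p)) in i , i∉p

-- Colours of a vertex and colours seen along a history.

module Colouring (𝓐 : Arena) {k : ℕ} (F : Fin k → Arena.Subset 𝓐) where

  open Arena 𝓐 using (V)

  colours : V → Subset k
  colours v = tabulate (λ i → F i v)

  ∈-colours⁺ : ∀ {i v} → T (F i v) → i ∈ colours v
  ∈-colours⁺ {i} t = lookup⇒[]= i _ (trans (lookup∘tabulate _ i) (Equivalence.to T-≡ t))

  ∈-colours⁻ : ∀ {i v} → i ∈ colours v → T (F i v)
  ∈-colours⁻ {i} i∈ = Equivalence.from T-≡ (trans (sym (lookup∘tabulate _ i)) ([]=⇒lookup i∈))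

  visited : List V → Subset k
  visited []      = empty
  visited (v ∷ w) = colours v ∪ visited w

-- Plays: tracing them step by step, invariants, sinks.

module PlayProperties (𝓐 : Arena) (v₀ : Arena.V 𝓐)
  (σ : Arena.Strategy 𝓐 eve) (τ : Arena.Strategy 𝓐 adam) where

  open Arena 𝓐 hiding (Subset)

  private
    pre  = prefix v₀ σ τ
    succ = next v₀ σ τ

  -- `prefix` does not reduce past a successor known only up to propositional equality; chaining
  -- this lemma traces a play through such equations.
  prefix-suc : ∀ n {w v u} → pre n ≡ (w , v) → proj₁ (succ w v) ≡ u → pre (suc n) ≡ (v ∷ w , u)
  prefix-suc n eq refl = cong (λ (w , v) → (v ∷ w) , proj₁ (succ w v)) eq

  finitePath : ∀ n → FinitePath (proj₁ (pre n)) (proj₂ (pre n))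
  finitePath zero    = start
  finitePath (suc n) = finitePath n ▷ proj₂ (succ _ _)

  finitePathAt : ∀ n {w v} → pre n ≡ (w , v) → FinitePath w v
  finitePathAt n refl = finitePath n

  -- The step receives the finite path because `UsedBy` constrains a strategy on paths only.
  invariant : (I : V → Set) → (∀ {w v} → FinitePath w v → I v → I (proj₁ (succ w v))) →
              I v₀ → ∀ n → I (proj₂ (pre n))
  invariant I step I₀ zero    = I₀
  invariant I step I₀ (suc n) = step (finitePath n) (invariant I step I₀ n)

  absorbed : ∀ {u} → (∀ {v} → T (edge u v) → v ≡ u) →
             ∀ {m n} → m ≤ n → proj₂ (pre m) ≡ u → proj₂ (pre n) ≡ u
  absorbed {u} loop {m} m≤n eq = go (ℕ.≤⇒≤′ m≤n)
    where
    go : ∀ {n} → m ≤′ n → proj₂ (pre n) ≡ u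
    go (≤′-reflexive refl) = eq
    go (≤′-step {n} m≤n)   =
      loop (subst (λ v → T (edge v _)) (go m≤n) (proj₂ (succ _ (proj₂ (pre n)))))

  module _ {k : ℕ} (F : Fin k → Arena.Subset 𝓐) where
    open Colouring 𝓐 F

    ∈-visited⁻ : ∀ {i} n → i ∈ visited (proj₁ (pre n)) → ∃[ p ] T (F i (proj₂ (pre p)))
    ∈-visited⁻ zero    i∈ = contradiction i∈ ∉⊥
    ∈-visited⁻ (suc n) i∈ with x∈p∪q⁻ _ _ i∈
    ... | inj₁ i∈colours = n , ∈-colours⁻ i∈colours
    ... | inj₂ i∈visited = ∈-visited⁻ n i∈visited

-- Eve's game: the arena.

module EveArena (k-1 : ℕ) where

  k = suc k-1

  pattern heart    = inj₁ tt
  pattern claim p  = inj₂ (inj₁ p)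
  pattern only i   = inj₂ (inj₂ (inj₁ i))
  pattern allBut i = inj₂ (inj₂ (inj₂ i))

  Vertex : Set
  Vertex = ⊤ ⊎ Subset k ⊎ Fin k ⊎ Fin k

  -- The single vertex `heart` hides which colours were visited, so a next-move function has to
  -- recover them from memory. At `claim p` each colour gives exactly one successor, selected by
  -- membership in `p`.
  edge : Vertex → Vertex → Bool
  edge heart      (claim _)  = true
  edge (claim p)  (only i)   = isNo (i ∈? p)
  edge (claim p)  (allBut i) = ⌊ i ∈? p ⌋
  edge (only _)   heart      = true
  edge (allBut i) (allBut j) = ⌊ j ≟ i ⌋
  edge _          _          = false

  challenge : ∀ p (i : Fin k) → ∃[ v ] T (edge (claim p) v)
  challenge p i with i ∈? p
  ... | yes i∈p = allBut i , fromWitness i∈p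
  ... | no  i∉p = only i   , fromWitnessFalse i∉p

  stay : ∀ i → T (edge (allBut i) (allBut i))
  stay i = fromWitness refl

  total : ∀ u → ∃[ v ] T (edge u v)
  total heart      = claim empty , tt
  total (claim p)  = challenge p zero
  total (only i)   = heart , tt
  total (allBut i) = allBut i , stay i

  owner : Vertex → Player
  owner heart = eve
  owner _     = adam

  𝓐 : Arena
  𝓐 = record
    { V      = Vertex
    ; size   = 1 + (2 ^ k + (k + k))
    ; finite = ⊤-finite ⊎-finite Subset-finite k ⊎-finite ↔-id _ ⊎-finite ↔-id _
    ; edge   = edge
    ; total  = total
    ; owner  = owner
    }

  F : Fin k → Vertex → Bool
  F i (only j)   = ⌊ i ≟ j ⌋
  F i (allBut j) = isNo (i ≟ j)
  F i _          = false

  open Arena 𝓐 using (Strategy; prefix; next; GenReach; play; MemoryStructure)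
  open Game (genReachGame 𝓐 F) using (Winning; Wins; WinsWithFewerStatesThan)
  open Colouring 𝓐 F

  allBut-injective : ∀ {i j : Fin k} → _≡_ {A = Vertex} (allBut i) (allBut j) → i ≡ j
  allBut-injective refl = refl

  heart-succ : ((v , _) : ∃[ v ] T (edge heart v)) → ∃[ p ] v ≡ claim p
  heart-succ (claim p , _) = p , refl

  claim-succ : ∀ {p} ((v , _) : ∃[ v ] T (edge (claim p) v)) →
               ∃[ i ] ((i ∈ p × v ≡ allBut i) ⊎ (i ∉ p × v ≡ only i))
  claim-succ (only i   , e) = i , inj₂ (toWitnessFalse e , refl)
  claim-succ (allBut i , e) = i , inj₁ (toWitness e , refl)

  only-succ : ∀ {i} ((v , _) : ∃[ v ] T (edge (only i) v)) → v ≡ heart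
  only-succ (heart , _) = refl

  allBut-loop : ∀ {i v} → T (edge (allBut i) v) → v ≡ allBut i
  allBut-loop {v = allBut j} e = cong (λ j → allBut j) (toWitness e)

  -- Eve's winning strategy.

  nameVisited : Strategy eve
  nameVisited w heart _ = claim (visited w) , tt

  nameVisited-winning : Winning eve nameVisited heart
  nameVisited-winning τ = fromHeart k 0 refl (ℕ.m≤m+n k _)
    where
    open PlayProperties 𝓐 heart nameVisited τ
    pre  = prefix heart nameVisited τ
    succ = next heart nameVisited τ

    -- Induction on `m`, a bound on the number of colours still unvisited. A challenge outside the
    -- visited set adds its colour before the next visit to the heart; a challenge inside it leads
    -- to a sink that has all the other colours.
    fromHeart : ∀ m n {w} → pre n ≡ (w , heart) → k ≤ m + ∣ visited w ∣ →
                GenReach F (play heart nameVisited τ)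
    fromHeart zero n {w} eq k≤∣w∣ i =
      ∈-visited⁻ F n (subst (i ∈_) (sym visited≡full) ∈⊤)
      where
      visited≡full : visited (proj₁ (pre n)) ≡ full
      visited≡full = trans (cong (visited ∘ proj₁) eq)
        (∣p∣≡n⇒p≡⊤ (ℕ.≤-antisym (∣p∣≤n (visited w)) k≤∣w∣))
    fromHeart (suc m) n {w} eq k≤ with claim-succ (succ (heart ∷ w) (claim (visited w)))
    ... | i , inj₁ (i∈w , to-allBut) = λ j → reach j
      where
      reach : ∀ j → ∃[ p ] T (F j (proj₂ (pre p)))
      reach j with j ≟ i
      -- The sink lacks only `i`, and `i` was visited earlier because it lies in the named set.
      ... | yes refl = ∈-visited⁻ F n (subst (λ c → j ∈ visited (proj₁ c)) (sym eq) i∈w)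
      ... | no  j≢i  = 2 + n , subst (λ c → T (F j (proj₂ c)))
        (sym (prefix-suc (1 + n) (prefix-suc n eq refl) to-allBut)) (fromWitnessFalse j≢i)
    ... | i , inj₂ (i∉w , to-only) = fromHeart m (3 + n) heartAgain
      (ℕ.≤-trans k≤ (ℕ.≤-trans (ℕ.≤-reflexive (sym (ℕ.+-suc m _)))
        (ℕ.+-monoʳ-≤ m (p⊂q⇒∣p∣<∣q∣ larger))))
      where
      w′ : List Vertex
      w′ = only i ∷ claim (visited w) ∷ heart ∷ w

      heartAgain : pre (3 + n) ≡ (w′ , heart)
      heartAgain = prefix-suc (2 + n) (prefix-suc (1 + n) (prefix-suc n eq refl) to-only)
        (only-succ (succ _ (only i)))

      larger : visited w ⊆ visited w′ × ∃[ j ] j ∈ visited w′ × j ∉ visited w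
      larger = (λ x∈w → x∈p∪q⁺ (inj₂ (x∈p∪q⁺ (inj₂ (x∈p∪q⁺ (inj₂ x∈w))))))
             , i , x∈p∪q⁺ (inj₁ (∈-colours⁺ {v = only i} (fromWitness refl))) , i∉w

  eve-wins : Wins eve heart
  eve-wins = nameVisited , nameVisited-winning

  -- Adam's reply to an Eve who never names the proper subset `p₀`.

  module Confining (p₀ : Subset k) (p₀≢full : p₀ ≢ full) where

    -- The play may stop only on a colour outside p₀; all that is visited before lies in p₀.
    Safe : Vertex → Set
    Safe heart      = ⊤
    Safe (claim p)  = p ≢ p₀
    Safe (only i)   = i ∈ p₀
    Safe (allBut i) = i ∉ p₀

    -- Adam challenges a colour on which `p` and `p₀` differ. Safety is conditional because a
    -- strategy has to move at `claim p₀` too.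
    safeChallenge : ∀ p → Σ[ u ∈ ∃[ v ] T (edge (claim p) v) ] (p ≢ p₀ → Safe (proj₁ u))
    safeChallenge p with p ⊆? p₀ | p₀ ⊆? p
    ... | no p⊈p₀ | _ =
      let (i , i∈p , i∉p₀) = ⊈⇒∃∈∉ p⊈p₀ in (allBut i , fromWitness i∈p) , λ _ → i∉p₀
    ... | yes _ | no p₀⊈p =
      let (i , i∈p₀ , i∉p) = ⊈⇒∃∈∉ p₀⊈p in (only i , fromWitnessFalse i∉p) , λ _ → i∈p₀
    -- Here `p` equals `p₀`, and colour `zero` is a default move.
    ... | yes p⊆p₀ | yes p₀⊆p =
      challenge p zero , λ p≢p₀ → contradiction (⊆-antisym p⊆p₀ p₀⊆p) p≢p₀

    confine : Strategy adam
    confine w (claim p)  _ = proj₁ (safeChallenge p)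
    confine w (only i)   _ = heart , tt
    confine w (allBut i) _ = allBut i , stay i

    -- A colour outside `p₀` can be seen only in a sink `allBut i` with `i` outside `p₀`. Seeing `i`
    -- as well would take a second, different sink, but a play never leaves the first sink it
    -- enters.
    confine-wins : (σ : Strategy eve) →
      (∀ {w} → Arena.FinitePath 𝓐 w heart → Safe (proj₁ (σ w heart refl))) →
      ¬ GenReach F (play heart σ confine)
    confine-wins σ avoids reach = stuck
      where
      open PlayProperties 𝓐 heart σ confine
      at = proj₂ ∘ prefix heart σ confine

      safe : ∀ n → Safe (at n)
      safe = invariant Safe
        (λ { {v = heart}    path _    → avoids path
           ; {v = claim p}  _    p≢p₀ → proj₂ (safeChallenge p) p≢p₀
           ; {v = only _}   _    _    → tt
           ; {v = allBut _} _    i∉p₀ → i∉p₀ }) tt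

      stoppedAt : ∀ {j v} → j ∉ p₀ → Safe v → T (F j v) → ∃[ i ] v ≡ allBut i × i ∉ p₀ × j ≢ i
      stoppedAt {v = only i}   j∉p₀ i∈p₀ t = contradiction (subst (_∈ p₀) (sym (toWitness t)) i∈p₀) j∉p₀
      stoppedAt {v = allBut i} j∉p₀ i∉p₀ t = i , refl , i∉p₀ , toWitnessFalse t

      unique : ∀ m n {i j} → at m ≡ allBut i → at n ≡ allBut j → j ≡ i
      unique m n at-m at-n with ℕ.≤-total m n
      ... | inj₁ m≤n = allBut-injective (trans (sym at-n) (absorbed allBut-loop m≤n at-m))
      ... | inj₂ n≤m = allBut-injective (trans (sym (absorbed allBut-loop n≤m at-n)) at-m)

      stuck : ⊥
      stuck =
        let (j , j∉p₀)                 = ≢full⇒∃∉ p₀≢full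
            (m , j-at-m)               = reach j
            (i , at-m , i∉p₀ , _)      = stoppedAt j∉p₀ (safe m) j-at-m
            (n , i-at-n)               = reach i
            (i′ , at-n , _ , i≢i′)     = stoppedAt i∉p₀ (safe n) i-at-n
        in i≢i′ (sym (unique m n at-m at-n))

  -- Eve's memory bound.

  named : Vertex → Subset k
  named (claim p) = p
  -- A next move is typed as an arbitrary vertex, so a default is needed; `full` is counted among
  -- the answers below anyway.
  named _         = full

  eve-needs : ¬ WinsWithFewerStatesThan (2 ^ k ∸ 1) eve heart
  eve-needs (𝓜 , (m , M↔ , m<) , σ , (ν , σ≡ν) , winning) =
    Confining.confine-wins p₀ p₀≢full σ avoids (winning (Confining.confine p₀ p₀≢full))
    where
    open MemoryStructure 𝓜 using (μ*)
    open Inverse M↔ using (to; from; inverseʳ)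

    -- Counting `full` among the named sets makes the missed one proper.
    answer : Fin (suc m) → Subset k
    answer zero    = full
    answer (suc j) = named (ν heart refl (from j))

    missedSet : ∃[ p ] (∀ j → answer j ≢ p)
    -- As `2 ^ k` is nonzero, `m < 2 ^ k ∸ 1` gives `suc m < 2 ^ k`, which leaves room for the extra
    -- answer.
    missedSet = missed (Subset-finite k) (ℕ.m≤pred[n]⇒suc[m]≤n {{ℕ.m^n≢0 2 k}} m<) answer
    p₀ = proj₁ missedSet

    p₀≢full : p₀ ≢ full
    p₀≢full = proj₂ missedSet zero ∘ sym

    avoids : ∀ {w} → Arena.FinitePath 𝓐 w heart →
             Confining.Safe p₀ p₀≢full (proj₁ (σ w heart refl))
    avoids {w} path with heart-succ (σ w heart refl)
    ... | p , to-claim = subst (Confining.Safe p₀ p₀≢full) (sym to-claim) p≢p₀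
      where
      p≢p₀ : p ≢ p₀
      -- The answer indexed by the memory state reached along `path` is the set named at this visit.
      p≢p₀ p≡p₀ = proj₂ missedSet (suc (to (μ* path)))
        (trans (cong (named ∘ ν heart refl) (inverseʳ refl))
          (trans (cong named (trans (sym (σ≡ν refl path)) to-claim)) p≡p₀))

-- Adam's game: the arena.

module AdamArena (k-1 : ℕ) where

  k = suc k-1

  half : ℕ
  half = ⌊ k /2⌋

  half<k : half < k
  half<k = ℕ.⌊n/2⌋<n k-1

  Half : Set
  Half = SizedSubset k half

  someHalf : Half
  someHalf = subsetOfSize (ℕ.<⇒≤ half<k)

  -- Provides Eve with a move at every claim: `half` is strictly below `k`, so a colour is left
  -- over.
  outsideHalf : ((p , _) : Half) → ∃[ i ] i ∉ p
  outsideHalf (p , ∣p∣≡half) = ≢full⇒∃∉ λ p≡full →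
    ℕ.<⇒≢ half<k (trans (sym ∣p∣≡half) (trans (cong ∣_∣ p≡full) (∣⊤∣≡n k)))

  distinguish : (p q : Half) → p ≢ q → ∃[ i ] i ∈ proj₁ p × i ∉ proj₁ q
  distinguish (p , ∣p∣≡half) (q , ∣q∣≡half) p≢q =
    ⊈⇒∃∈∉ (∣p∣≡∣q∣∧≢⇒⊈ (trans ∣p∣≡half (sym ∣q∣≡half)) (p≢q ∘ SizedSubset-≡))

  pattern start    = inj₁ tt
  pattern ask      = inj₂ (inj₁ tt)
  pattern visit p  = inj₂ (inj₂ (inj₁ p))
  pattern claim p  = inj₂ (inj₂ (inj₂ (inj₁ p)))
  pattern allBut i = inj₂ (inj₂ (inj₂ (inj₂ i)))

  Vertex : Set
  Vertex = ⊤ ⊎ ⊤ ⊎ Half ⊎ Half ⊎ Fin k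

  -- All visits pass through the single vertex `ask`, so Adam can know the visited set only through
  -- memory.
  edge : Vertex → Vertex → Bool
  edge start           (visit _)  = true
  edge (visit _)       ask        = true
  edge ask             (claim _)  = true
  edge (claim (p , _)) (allBut i) = isNo (i ∈? p)
  edge (allBut i)      (allBut j) = ⌊ j ≟ i ⌋
  edge _               _          = false

  stay : ∀ i → T (edge (allBut i) (allBut i))
  stay i = fromWitness refl

  concede : ∀ p → ∃[ v ] T (edge (claim p) v)
  concede p = let (i , i∉p) = outsideHalf p in allBut i , fromWitnessFalse i∉p

  total : ∀ u → ∃[ v ] T (edge u v)
  total start      = visit someHalf , tt
  total (visit _)  = ask , tt
  total ask        = claim someHalf , tt
  total (claim p)  = concede p
  total (allBut i) = allBut i , stay i

  owner : Vertex → Player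
  owner start     = eve
  owner (claim _) = eve
  owner _         = adam

  𝓐 : Arena
  𝓐 = record
    { V      = Vertex
    ; size   = 1 + (1 + (k C half + (k C half + k)))
    ; finite = ⊤-finite ⊎-finite ⊤-finite ⊎-finite SizedSubset-finite k half
                 ⊎-finite SizedSubset-finite k half ⊎-finite ↔-id _
    ; edge   = edge
    ; total  = total
    ; owner  = owner
    }

  F : Fin k → Vertex → Bool
  F i (visit (p , _)) = ⌊ i ∈? p ⌋
  F i (allBut j)      = isNo (i ≟ j)
  F i _               = false

  open Arena 𝓐 using (Strategy; prefix; GenReach; play; MemoryStructure)
  open Game (genReachGame 𝓐 F) using (Winning; Wins; WinsWithFewerStatesThan)

  start-succ : ((v , _) : ∃[ v ] T (edge start v)) → ∃[ p ] v ≡ visit p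
  start-succ (visit p , _) = p , refl

  visit-succ : ∀ {p} ((v , _) : ∃[ v ] T (edge (visit p) v)) → v ≡ ask
  visit-succ (ask , _) = refl

  ask-succ : ((v , _) : ∃[ v ] T (edge ask v)) → ∃[ p ] v ≡ claim p
  ask-succ (claim p , _) = p , refl

  claim-succ : ∀ {p} ((v , _) : ∃[ v ] T (edge (claim p) v)) → ∃[ i ] i ∉ proj₁ p × v ≡ allBut i
  claim-succ (allBut i , e) = i , toWitnessFalse e , refl

  allBut-loop : ∀ {i v} → T (edge (allBut i) v) → v ≡ allBut i
  allBut-loop {v = allBut j} e = cong (λ j → allBut j) (toWitness e)

  -- Adam's winning strategy.

  lastVisit : List Vertex → Half
  -- Words have the most recent vertex first, so at `ask` the head of the history is Eve's choice.
  lastVisit (visit p ∷ _) = p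
  lastVisit _             = someHalf

  repeatVisit : Strategy adam
  repeatVisit w (visit _)  _ = ask , tt
  repeatVisit w ask        _ = claim (lastVisit w) , tt
  repeatVisit w (allBut i) _ = allBut i , stay i

  -- The colour `i` that Eve picks at the claim lies outside the claimed set, which is the set she
  -- visited, and the sink `allBut i` lacks it as well; so it is never seen.
  repeatVisit-winning : Winning adam repeatVisit start
  repeatVisit-winning σ reach with start-succ (σ [] start refl)
  ... | p , to-visit with claim-succ (σ (ask ∷ visit p ∷ start ∷ []) (claim p) refl)
  ...   | i , i∉p , to-allBut = let (n , i-at-n) = reach i in avoided n i-at-n
    where
    open PlayProperties 𝓐 start σ repeatVisit
    pre = prefix start σ repeatVisit

    at₁ : pre 1 ≡ (start ∷ [] , visit p)
    at₁ = prefix-suc 0 refl to-visit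

    at₂ : pre 2 ≡ (visit p ∷ start ∷ [] , ask)
    at₂ = prefix-suc 1 at₁ refl

    at₃ : pre 3 ≡ (ask ∷ visit p ∷ start ∷ [] , claim p)
    at₃ = prefix-suc 2 at₂ refl

    at₄ : pre 4 ≡ (claim p ∷ ask ∷ visit p ∷ start ∷ [] , allBut i)
    at₄ = prefix-suc 3 at₃ to-allBut

    avoided : ∀ n → ¬ T (F i (proj₂ (pre n)))
    avoided 0 t = t
    avoided 1 t = i∉p (toWitness (subst (T ∘ F i ∘ proj₂) at₁ t))
    avoided 2 t = subst (T ∘ F i ∘ proj₂) at₂ t
    avoided 3 t = subst (T ∘ F i ∘ proj₂) at₃ t
    avoided n@(suc (suc (suc (suc _)))) t = toWitnessFalse
      (subst (T ∘ F i) (absorbed allBut-loop {4} {n} (ℕ.m≤m+n 4 _) (cong proj₂ at₄)) t) refl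

  adam-wins : Wins adam start
  adam-wins = repeatVisit , repeatVisit-winning

  -- Eve's reply to an Adam who never claims `p₀`.

  module Refuting (p₀ : Half) where

    refutation : ∀ q → Σ[ u ∈ ∃[ v ] T (edge (claim q) v) ]
                         (p₀ ≢ q → ∃[ i ] i ∈ proj₁ p₀ × proj₁ u ≡ allBut i)
    refutation q with proj₁ p₀ ⊆? proj₁ q
    ... | no p₀⊈q =
      let (i , i∈p₀ , i∉q) = ⊈⇒∃∈∉ p₀⊈q
      in (allBut i , fromWitnessFalse i∉q) , λ _ → i , i∈p₀ , refl
    -- Equal sizes turn this inclusion into equality, so the promise is vacuous and any legal move
    -- will do.
    ... | yes p₀⊆q = concede q , λ p₀≢q →
      let (_ , i∈p₀ , i∉q) = distinguish p₀ q p₀≢q in contradiction (p₀⊆q i∈p₀) i∉q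

    refute : Strategy eve
    refute w start      _ = visit p₀ , tt
    refute w (claim q)  _ = proj₁ (refutation q)

    -- The final sink lacks a single colour, and this one was taken from `p₀`, hence seen at
    -- position 1.
    refute-wins : (τ : Strategy adam) →
      (∀ {w} → Arena.FinitePath 𝓐 w ask → proj₁ (τ w ask refl) ≢ claim p₀) →
      GenReach F (play start refute τ)
    refute-wins τ avoids with ask-succ (τ (visit p₀ ∷ start ∷ []) ask refl)
    ... | q , to-claim = reach
      where
      open PlayProperties 𝓐 start refute τ
      pre = prefix start refute τ

      at₂ : pre 2 ≡ (visit p₀ ∷ start ∷ [] , ask)
      at₂ = prefix-suc 1 refl (visit-succ (τ (start ∷ []) (visit p₀) refl))

      at₃ : pre 3 ≡ (ask ∷ visit p₀ ∷ start ∷ [] , claim q)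
      at₃ = prefix-suc 2 at₂ to-claim

      p₀≢q : p₀ ≢ q
      p₀≢q refl = avoids (finitePathAt 2 at₂) to-claim

      reach : GenReach F (play start refute τ)
      reach j with proj₂ (refutation q) p₀≢q
      ... | i , i∈p₀ , to-allBut with j ≟ i
      ...   | yes refl = 1 , fromWitness i∈p₀
      ...   | no  j≢i  = 4 , subst (T ∘ F j ∘ proj₂) (sym (prefix-suc 3 at₃ to-allBut))
                               (fromWitnessFalse j≢i)

  -- Adam's memory bound.

  named : Vertex → Half
  named (claim p) = p
  named _         = someHalf

  -- Each memory state fixes at most one claim at `ask`, so with fewer states than half-size sets
  -- some `p₀` is never claimed; Eve visits exactly that set.
  adam-needs : ¬ WinsWithFewerStatesThan (k C half) adam start
  adam-needs (𝓜 , (m , M↔ , m<) , τ , (ν , τ≡ν) , winning) =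
    winning (Refuting.refute p₀) (Refuting.refute-wins p₀ τ avoids)
    where
    open MemoryStructure 𝓜 using (μ*)
    open Inverse M↔ using (to; from; inverseʳ)

    answer : Fin m → Half
    answer j = named (ν ask refl (from j))

    missedHalf : ∃[ p ] (∀ j → answer j ≢ p)
    missedHalf = missed (SizedSubset-finite k half) m< answer
    p₀ = proj₁ missedHalf

    avoids : ∀ {w} → Arena.FinitePath 𝓐 w ask → proj₁ (τ w ask refl) ≢ claim p₀
    avoids path to-claim = proj₂ missedHalf (to (μ* path))
      (trans (cong (named ∘ ν ask refl) (inverseʳ refl))
        (cong named (trans (sym (τ≡ν refl path)) to-claim)))

lemma2 : ∀ (k : ℕ) → 1 ≤ k →
    (Σ[ 𝓐 ∈ Arena ] Σ[ F ∈ (Fin k → Arena.Subset 𝓐) ] Σ[ v₀ ∈ Arena.V 𝓐 ]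
    (Game.Wins (genReachGame 𝓐 F) eve v₀
    × ¬ Game.WinsWithFewerStatesThan (genReachGame 𝓐 F) (2 ^ k ∸ 1) eve v₀))
    ×
    (Σ[ 𝓐 ∈ Arena ] Σ[ F ∈ (Fin k → Arena.Subset 𝓐) ] Σ[ v₀ ∈ Arena.V 𝓐 ]
    (Game.Wins (genReachGame 𝓐 F) adam v₀
    × ¬ Game.WinsWithFewerStatesThan (genReachGame 𝓐 F) (k C ⌊ k /2⌋) adam v₀))
lemma2 (suc k-1) _ =
    (E.𝓐 , E.F , E.heart , E.eve-wins , E.eve-needs)
  , (A.𝓐 , A.F , A.start , A.adam-wins , A.adam-needs)
  where
  module E = EveArena k-1
  module A = AdamArena k-1
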